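{- Let $k\ge 3$. For every greedy adaptive priority algorithm $A$ in the vertex model for $k$-uniform hypergraph matching there exists a $k$-uniform hypergraph $H$ such that the matching computed by $A$ on $H$ has size at most $\frac1k\,\nu(H)$. That is, no such algorithm achieves an approximation ratio better than $\frac1k$.
   Context: A $k$-uniform hypergraph $H=(V,E)$ has hyperedges that are $k$-element subsets of $V$; a matching is a set of pairwise disjoint hyperedges and $\nu(H)$ is the maximum size of a matching. Vertex model: the data item of a node $u$ is $\langle u;V_1,\dots,V_d\rangle$, where $\{u\}\cup V_1,\dots,\{u\}\cup V_d$ are all hyperedges containing $u$. A greedy adaptive priority algorithm proceeds in rounds: in each round it deterministically chooses, as a function only of the data items received and decisions made so far (without otherwise looking at the input), a total order on all possible data items, and receives the first data item (w.r.t. this order) of the input whose node $u$ is uncovered and lies in some hyperedge all of whose nodes are uncovered; it must then irrevocably add to its matching some hyperedge containing $u$ all of whose nodes are uncovered. This repeats until no such node remains. -}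

module Defs where

open import Data.Nat using (ℕ; _<_; _≟_; _⊔_)
open import Data.Nat.Properties using (<-strictTotalOrder)
open import Data.List using (List; []; _∷_; map; filter; length; foldr; concatMap; _++_)
open import Data.List.Relation.Unary.All using (All)
open import Data.List.Relation.Unary.All as All using (all?)
open import Data.List.Relation.Unary.Any using (Any; any?)
open import Data.List.Relation.Unary.AllPairs using (AllPairs; allPairs?)
open import Data.List.Relation.Unary.Linked using (Linked)
open import Data.List.Relation.Binary.Lex.Strict using (Lex-<)
open import Data.List.Membership.Propositional using (_∈_; _∉_)
open import Data.List.Membership.DecPropositional _≟_ using (_∈?_)
open import Data.Maybe using (Maybe; just; nothing)
open import Data.Product using (_×_; _,_; proj₁; proj₂)
open import Relation.Nullary using (¬?; _×-dec_)
open import Relation.Binary.PropositionalEquality using (_≡_)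
open import Relation.Binary.Structures using (IsStrictTotalOrder)
open import Relation.Binary.Definitions using (tri<; tri≈; tri>)

-- Hypergraphs.  Nodes are natural numbers.  A hyperedge is represented
-- canonically as a strictly increasing list of nodes, and the hyperedge
-- set canonically as a lexicographically strictly increasing list of
-- hyperedges (so every finite k-uniform hypergraph without isolated
-- vertices has exactly one representation; isolated vertices are
-- irrelevant for matchings and are never received by the algorithm).

Edge : Set
Edge = List ℕ

record Hypergraph (k : ℕ) : Set where
  field
    edges     : List Edge
    sorted    : All (Linked _<_) edges
    uniform   : All (λ e → length e ≡ k) edges
    canonical : Linked (Lex-< _≡_ _<_) edges
open Hypergraph public

vertices : ∀ {k} → Hypergraph k → List ℕ
vertices H = concatMap (λ e → e) (edges H)

Disjoint : Edge → Edge → Set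
Disjoint e f = All (_∉ f) e

IsMatching : List Edge → Set
IsMatching = AllPairs Disjoint

sublists : {A : Set} → List A → List (List A)
sublists []       = [] ∷ []
sublists (x ∷ xs) = map (x ∷_) (sublists xs) ++ sublists xs

maximum : List ℕ → ℕ
maximum = foldr _⊔_ 0

ν : ∀ {k} → Hypergraph k → ℕ
ν H = maximum (map length
        (filter (allPairs? (λ e f → all? (λ x → ¬? (x ∈? f)) e))
                (sublists (edges H))))

-- Vertex model.  Data item ⟨u ; V₁ , … , V_d⟩ : the node u together with
-- the list of the sets Vᵢ = eᵢ ∖ {u} for the hyperedges eᵢ ∋ u
-- (in the canonical order of the hyperedges).

Item : Set
Item = ℕ × List Edge

remove : ℕ → Edge → Edge
remove u = filter (λ x → ¬? (x ≟ u))

dataItem : ∀ {k} → Hypergraph k → ℕ → Item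
dataItem H u = u , map (remove u) (filter (u ∈?_) (edges H))

-- History: list of (received data item, chosen Vᵢ) pairs, most recent
-- first.  The matching edge added in that round is u ∪ Vᵢ.
History : Set
History = List (Item × Edge)

covered : History → List ℕ
covered = concatMap (λ p → proj₁ (proj₁ p) ∷ proj₂ p)

Free : History → Edge → Set
Free h e = All (_∉ covered h) e

record Algorithm : Set₁ where
  field
    order        : History → Item → Item → Set
    order-sto    : ∀ h → IsStrictTotalOrder _≡_ (order h)
    choose       : History → Item → Edge
    choose-valid : ∀ h u Vs → Any (Free h) Vs →
                   (choose h (u , Vs) ∈ Vs) × Free h (choose h (u , Vs))
open Algorithm public

firstItem : (A : Algorithm) → History → List Item → Maybe Item
firstItem A h []       = nothing
firstItem A h (x ∷ xs) with firstItem A h xs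
... | nothing = just x
... | just y  with IsStrictTotalOrder.compare (order-sto A h) x y
...   | tri< _ _ _ = just x
...   | tri≈ _ _ _ = just x
...   | tri> _ _ _ = just y

eligibleNodes : ∀ {k} → Hypergraph k → History → List ℕ
eligibleNodes H h =
  filter (λ u → any? (λ e → (u ∈? e) ×-dec all? (λ x → ¬? (x ∈? covered h)) e)
                     (edges H))
         (vertices H)

runFrom : (A : Algorithm) → ∀ {k} → Hypergraph k → ℕ → History → History
runFrom A H ℕ.zero    h = h
runFrom A H (ℕ.suc n) h with firstItem A h (map (dataItem H) (eligibleNodes H h))
... | nothing = h
... | just it = runFrom A H n ((it , choose A h it) ∷ h)

-- Every round adds a hyperedge of H disjoint from the previous ones, so
-- |E(H)| rounds suffice for the algorithm to terminate.
run : Algorithm → ∀ {k} → Hypergraph k → History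
run A H = runFrom A H (length (edges H)) []

-- size of the matching computed by A on H (one hyperedge per round)
output : Algorithm → ∀ {k} → Hypergraph k → ℕ
output A H = length (run A H)

{-# OPTIONS --safe #-}
module Submission where

-- One round of the algorithm suffices.  Call a hypergraph rich at w if it has
-- an edge at w and every edge g ∋ w is met only in w by some edge f ∋ w.  Over
-- a large finite set of labels, consider all data items of rich nodes, and let
-- the item of u in the hypergraph G be the first of them in the initial order;
-- say that A reacts to it with the edge e ∋ u.  The adversary keeps the edges
-- of G at u and adds all k-sets that avoid u, meet e and miss some node of
-- e ∖ {u}.  This hypergraph is rich at all of its nodes (here k ≥ 3 is used),
-- so A does start with u and e; since e meets every edge, A then stops.  But
-- there are k disjoint edges, one through each node of e.

open import Defs
open import Data.Nat using (ℕ; zero; suc; _+_; _∸_; _≤_; _<_; _*_; _≟_; z≤n; s≤s)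
open import Data.Nat.Properties
  using (≤-refl; ≤-trans; ≤-reflexive; ≤-antisym; <⇒≤; <⇒≱; <-≤-trans; <-irrefl; <-isStrictPartialOrder;
         suc-injective; +-identityʳ; *-identityʳ; +-suc; m≤n+m; m∸n+n≡m; m≤m⊔n; m≤n⊔m;
         +-monoˡ-≤; +-monoʳ-<; *-monoˡ-≤; *-monoʳ-≤; module ≤-Reasoning)
open import Data.List using (List; []; _∷_; map; filter; length; concat; _++_; upTo; cartesianProduct)
open import Data.List.Properties
  using (length-++; length-upTo; filter-notAll; filter-all; filter-none; filter-accept; filter-reject; ≡-dec)
open import Data.List.Membership.Propositional using (_∈_; _∉_; find; lose)
open import Data.List.Membership.Propositional.Properties
open import Data.List.Membership.DecPropositional _≟_ using (_∈?_)
open import Data.List.Membership.DecPropositional (≡-dec _≟_) using () renaming (_∈?_ to _∈ᴱ?_)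
open import Data.List.Relation.Binary.Subset.Propositional using (_⊆_)
open import Data.List.Relation.Binary.Lex.Strict using (Lex-<; <-irreflexive; this; next)
  renaming (<-isStrictPartialOrder to Lex-<-isStrictPartialOrder)
open import Data.List.Relation.Binary.Pointwise using (≡⇒Pointwise-≡)
open import Data.List.Relation.Unary.All as All using (All; []; _∷_; all?)
import Data.List.Relation.Unary.All.Properties as Allₚ
open import Data.List.Relation.Unary.AllPairs as AllPairs using (AllPairs; []; _∷_; allPairs?)
import Data.List.Relation.Unary.AllPairs.Properties as AllPairsₚ
open import Data.List.Relation.Unary.Any as Any using (Any; here; there; any?)
open import Data.List.Relation.Unary.Linked.Properties using (AllPairs⇒Linked; Linked⇒AllPairs)
open import Data.List.Relation.Unary.Unique.Propositional using (Unique)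
import Data.List.Relation.Unary.Unique.Propositional.Properties as Uniqueₚ
open import Data.Maybe using (just)
open import Data.Product using (Σ; ∃; _×_; _,_; proj₁; proj₂)
open import Data.Sum using (_⊎_; inj₁; inj₂)
open import Function using (_∘_; id)
open import Level using (Level)
open import Relation.Binary.Core using (Rel)
open import Relation.Binary.Definitions using (Symmetric; tri<; tri≈; tri>)
open import Relation.Binary.PropositionalEquality
  using (_≡_; _≢_; refl; sym; trans; cong; cong₂; subst)
open import Relation.Binary.Structures using (IsStrictPartialOrder; IsStrictTotalOrder)
open import Relation.Nullary using (¬_; Dec; yes; no; ¬?; contradiction; _×-dec_; _⊎-dec_; _→-dec_)
open import Relation.Nullary.Decidable using (decidable-stable)
open import Relation.Unary using (Pred; Decidable)
open import Relation.Unary.Properties using (U?)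

private
  variable
    a p q r : Level
    X : Set a

-- Lists

unique-⊆⇒length-≤ : {xs ys : List X} → Unique xs → xs ⊆ ys → length xs ≤ length ys
unique-⊆⇒length-≤ [] _ = z≤n
unique-⊆⇒length-≤ {xs = x ∷ xs} (x∉ ∷ xs!) sub with ∈-∃++ (sub (here refl))
... | as , bs , refl = ≤-trans (s≤s (unique-⊆⇒length-≤ xs! sub′)) (≤-reflexive len)
  where
  sub′ : xs ⊆ as ++ bs
  sub′ z∈ with ∈-++⁻ as (sub (there z∈))
  ... | inj₁ z∈as         = ∈-++⁺ˡ z∈as
  ... | inj₂ (here refl)  = contradiction refl (All.lookup x∉ z∈)
  ... | inj₂ (there z∈bs) = ∈-++⁺ʳ as z∈bs
  len : suc (length (as ++ bs)) ≡ length (as ++ x ∷ bs)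
  len rewrite length-++ as {bs} | length-++ as {x ∷ bs} = sym (+-suc (length as) (length bs))

longer⇒∃∉ : {xs ys : List ℕ} → Unique xs → length ys < length xs → ∃ λ x → x ∈ xs × x ∉ ys
longer⇒∃∉ {xs} {ys} xs! ys<xs with any? (λ x → ¬? (x ∈? ys)) xs
... | yes p = find p
... | no ¬p = contradiction
  (unique-⊆⇒length-≤ xs! λ {x} x∈ → decidable-stable (x ∈? ys) (¬p ∘ lose x∈))
  (<⇒≱ ys<xs)

∈⇒≤maximum : ∀ {n} {ns : List ℕ} → n ∈ ns → n ≤ maximum ns
∈⇒≤maximum {ns = m ∷ ns} (here refl) = m≤m⊔n m (maximum ns)
∈⇒≤maximum {ns = m ∷ ns} (there n∈)  = ≤-trans (∈⇒≤maximum n∈) (m≤n⊔m m (maximum ns))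

length-concat : ∀ {n} {xss : List (List X)} → All (λ xs → length xs ≡ n) xss →
                length (concat xss) ≡ length xss * n
length-concat []                          = refl
length-concat {xss = xs ∷ _} (len ∷ lens) = trans (length-++ xs) (cong₂ _+_ len (length-concat lens))

AllPairs-lookup : {R : Rel X r} → Symmetric R → ∀ {xs x y} → AllPairs R xs →
                  x ∈ xs → y ∈ xs → x ≢ y → R x y
AllPairs-lookup s _          (here refl) (here refl) x≢y = contradiction refl x≢y
AllPairs-lookup s (px ∷ _)   (here refl) (there y∈)  _   = All.lookup px y∈
AllPairs-lookup s (px ∷ _)   (there x∈)  (here refl) _   = s (All.lookup px x∈)
AllPairs-lookup s (_  ∷ pxs) (there x∈)  (there y∈)  x≢y = AllPairs-lookup s pxs x∈ y∈ x≢y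

-- All hypergraphs below are filters of one fixed list of candidate edges. Agreement of two filters
-- on the edges at a node thus yields equal data items, as lists and not just up to order.
filter-filter-cong :
  {P : Pred X p} {Q : Pred X q} {R : Pred X r}
  (P? : Decidable P) (Q? : Decidable Q) (R? : Decidable R) (xs : List X) →
  (∀ {x} → x ∈ xs → R x → (P x → Q x) × (Q x → P x)) →
  filter R? (filter P? xs) ≡ filter R? (filter Q? xs)
filter-filter-cong P? Q? R? []       _   = refl
filter-filter-cong P? Q? R? (x ∷ xs) P⇔Q
  with P? x | Q? x | R? x | filter-filter-cong P? Q? R? xs (P⇔Q ∘ there)
... | no  _  | no  _  | _     | ih = ih
... | yes _  | yes _  | yes r | ih
  rewrite filter-accept R? {xs = filter P? xs} r | filter-accept R? {xs = filter Q? xs} r = cong (x ∷_) ih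
... | yes _  | yes _  | no ¬r | ih
  rewrite filter-reject R? {xs = filter P? xs} ¬r | filter-reject R? {xs = filter Q? xs} ¬r = ih
... | yes Px | no ¬Qx | yes r | _  = contradiction (proj₁ (P⇔Q (here refl) r) Px) ¬Qx
... | no ¬Px | yes Qx | yes r | _  = contradiction (proj₂ (P⇔Q (here refl) r) Qx) ¬Px
... | yes _  | no _   | no ¬r | ih rewrite filter-reject R? {xs = filter P? xs} ¬r = ih
... | no _   | yes _  | no ¬r | ih rewrite filter-reject R? {xs = filter Q? xs} ¬r = ih

filter∈sublists : {P : Pred X p} (P? : Decidable P) (xs : List X) → filter P? xs ∈ sublists xs
filter∈sublists P? []       = here refl
filter∈sublists P? (x ∷ xs) with P? x
... | yes _ = ∈-++⁺ˡ (∈-map⁺ (x ∷_) (filter∈sublists P? xs))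
... | no  _ = ∈-++⁺ʳ (map (x ∷_) (sublists xs)) (filter∈sublists P? xs)

sublists-⊆ : ∀ {xs ys : List X} → ys ∈ sublists xs → ys ⊆ xs
sublists-⊆ {xs = []} (here refl) = id
sublists-⊆ {xs = x ∷ xs} ys∈ z∈ with ∈-++⁻ (map (x ∷_) (sublists xs)) ys∈
... | inj₂ ys∈′ = there (sublists-⊆ ys∈′ z∈)
... | inj₁ ys∈′ with ∈-map⁻ (x ∷_) ys∈′ | z∈
...   | zs , zs∈ , refl | here z≡   = here z≡
...   | zs , zs∈ , refl | there z∈′ = there (sublists-⊆ zs∈ z∈′)

sublists-AllPairs : {R : Rel X r} {xs ys : List X} → AllPairs R xs → ys ∈ sublists xs → AllPairs R ys
sublists-AllPairs {xs = []} _ (here refl) = []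
sublists-AllPairs {xs = x ∷ xs} (px ∷ pxs) ys∈ with ∈-++⁻ (map (x ∷_) (sublists xs)) ys∈
... | inj₂ ys∈′ = sublists-AllPairs pxs ys∈′
... | inj₁ ys∈′ with ∈-map⁻ (x ∷_) ys∈′
...   | zs , zs∈ , refl = Allₚ.anti-mono (sublists-⊆ zs∈) px ∷ sublists-AllPairs pxs zs∈

-- sublists lists longer lists before their prefixes, hence the length hypothesis.
sublists-Lex : ∀ {xs} → AllPairs _<_ xs →
  AllPairs (λ ys zs → length ys ≡ length zs → Lex-< _≡_ _<_ ys zs) (sublists xs)
sublists-Lex [] = [] ∷ []
sublists-Lex {x ∷ xs} (x< ∷ xs<) = AllPairsₚ.++⁺
  (AllPairsₚ.map⁺ (AllPairs.map (λ lex eq → next refl (lex (suc-injective eq))) (sublists-Lex xs<)))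
  (sublists-Lex xs<)
  (Allₚ.map⁺ (All.universal (λ ys → All.tabulate (cross ys)) (sublists xs)))
  where
  cross : ∀ ys {zs} → zs ∈ sublists xs → length (x ∷ ys) ≡ length zs → Lex-< _≡_ _<_ (x ∷ ys) zs
  cross ys {_ ∷ _} zs∈ _ = this (All.lookup x< (sublists-⊆ zs∈ (here refl)))

-- Matchings

Disjoint-sym : Symmetric Disjoint
Disjoint-sym e#f = All.tabulate λ x∈f x∈e → All.lookup e#f x∈e x∈f

-- The empty edge is disjoint from itself, so non-emptiness is what excludes repetitions.
IsMatching⇒Unique : ∀ {M} → IsMatching M → All (λ e → 0 < length e) M → Unique M
IsMatching⇒Unique []        []          = []
IsMatching⇒Unique (e# ∷ M#) (e>0 ∷ M>0) = All.map (distinct e>0) e# ∷ IsMatching⇒Unique M# M>0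
  where
  distinct : ∀ {e f} → 0 < length e → Disjoint e f → e ≢ f
  distinct {x ∷ _} _ (x∉ ∷ _) refl = x∉ (here refl)

edges-unique : ∀ {k} (H : Hypergraph k) → Unique (edges H)
edges-unique H = AllPairs.map (λ e<f e≡f → <-irreflexive <-irrefl (≡⇒Pointwise-≡ e≡f) e<f)
  (Linked⇒AllPairs (IsStrictPartialOrder.trans (Lex-<-isStrictPartialOrder <-isStrictPartialOrder)) (canonical H))

-- `ν` inspects only sublists of `edges H`, so `M` is first put into canonical order by filtering
-- `edges H` for membership in `M`. This does not lose size because `M` has no repetitions.
matching≤ν : ∀ {k} (H : Hypergraph k) {M} → 0 < k → IsMatching M → M ⊆ edges H → length M ≤ ν H
matching≤ν H {M} 0<k M# M⊆ = ≤-trans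
  (unique-⊆⇒length-≤ (IsMatching⇒Unique M# (All.tabulate nonempty)) λ e∈M → ∈-filter⁺ (_∈ᴱ? M) (M⊆ e∈M) e∈M)
  (∈⇒≤maximum (∈-map⁺ length (∈-filter⁺ (allPairs? _) (filter∈sublists (_∈ᴱ? M) (edges H)) M′#)))
  where
  nonempty : ∀ {e} → e ∈ M → 0 < length e
  nonempty e∈M = subst (0 <_) (sym (All.lookup (uniform H) (M⊆ e∈M))) 0<k
  matching : ∀ {M′} → Unique M′ → M′ ⊆ M → IsMatching M′
  matching [] _ = []
  matching (e≢ ∷ M′!) sub =
    All.tabulate (λ f∈ → AllPairs-lookup Disjoint-sym M# (sub (here refl)) (sub (there f∈)) (All.lookup e≢ f∈))
    ∷ matching M′! (sub ∘ there)
  M′# : IsMatching (filter (_∈ᴱ? M) (edges H))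
  M′# = matching (Uniqueₚ.filter⁺ (_∈ᴱ? M) (edges-unique H)) (proj₂ ∘ ∈-filter⁻ (_∈ᴱ? M) {xs = edges H})

-- Runs

firstItem-least : ∀ A h z zs → ∃ λ y → firstItem A h (z ∷ zs) ≡ just y × y ∈ z ∷ zs ×
                  (∀ {w} → w ∈ z ∷ zs → ¬ order A h w y)
firstItem-least A h z [] = z , refl , here refl , λ { (here refl) → irrefl refl }
  where open IsStrictTotalOrder (order-sto A h)
firstItem-least A h z (z′ ∷ zs) with firstItem-least A h z′ zs
... | y , eq , y∈ , least rewrite eq with IsStrictTotalOrder.compare (order-sto A h) z y
...   | tri> ¬z<y _ _ = y , refl , there y∈ , λ { (here refl) → ¬z<y ; (there w∈) → least w∈ }
...   | tri≈ _ refl _ = z , refl , here refl ,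
  λ { (here refl) → IsStrictTotalOrder.irrefl (order-sto A h) refl ; (there w∈) → least w∈ }
...   | tri< z<y _ _  = z , refl , here refl ,
  λ { (here refl) → IsStrictTotalOrder.irrefl (order-sto A h) refl
    ; (there w∈) w<z → least w∈ (IsStrictTotalOrder.trans (order-sto A h) w<z z<y) }

-- This lets the adversary fix the first item before the input: the first of all rich items stays
-- first when the list shrinks to the items of one hypergraph. A strict comparison of the two minima
-- either way contradicts minimality.
firstItem-⊆ : ∀ A h {xs ys x} → firstItem A h ys ≡ just x → xs ⊆ ys → x ∈ xs → firstItem A h xs ≡ just x
firstItem-⊆ A h {z ∷ xs} {z′ ∷ ys} {x} eq sub x∈ with firstItem-least A h z xs | firstItem-least A h z′ ys
... | y , eq₁ , y∈ , y≤ | x′ , eq₂ , _ , x≤ with trans (sym eq) eq₂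
...   | refl with IsStrictTotalOrder.compare (order-sto A h) x y
...     | tri< x<y _ _ = contradiction x<y (y≤ x∈)
...     | tri≈ _ refl _ = eq₁
...     | tri> _ _ y<x = contradiction y<x (x≤ (sub y∈))
firstItem-⊆ A h {_ ∷ _} {[]} _ sub _ with sub (here refl)
... | ()

firstItem-just : ∀ A h {ys y} → y ∈ ys → ∃ λ x → firstItem A h ys ≡ just x
firstItem-just A h {z ∷ ys} _ with firstItem-least A h z ys
... | x , eq , _ = x , eq

firstItem-∈ : ∀ A h {ys x} → firstItem A h ys ≡ just x → x ∈ ys
firstItem-∈ A h {z ∷ ys} eq with firstItem-least A h z ys
... | y , eq′ , y∈ , _ with trans (sym eq) eq′
...   | refl = y∈

covered⇒eligible≡[] : ∀ {k} (H : Hypergraph k) h → (∀ {g} → g ∈ edges H → Any (_∈ covered h) g) →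
                      eligibleNodes H h ≡ []
covered⇒eligible≡[] H h hit = filter-none _ (All.universal (λ _ → ineligible) (vertices H))
  where
  ineligible : ∀ {v} → ¬ Any (λ e → v ∈ e × Free h e) (edges H)
  ineligible p with find p
  ... | g , g∈ , _ , free = Allₚ.All¬⇒¬Any free (hit g∈)

-- Once every edge meets the chosen one, no node is eligible, so the remaining rounds leave the
-- history alone, however many there are.
runFrom-single : ∀ A {k} (H : Hypergraph k) {u Vs} →
  firstItem A [] (map (dataItem H) (eligibleNodes H [])) ≡ just (u , Vs) →
  (∀ {g} → g ∈ edges H → Any (_∈ u ∷ choose A [] (u , Vs)) g) →
  ∀ n → length (runFrom A H n []) ≤ 1
runFrom-single A H first hit zero = z≤n
runFrom-single A H {u} {Vs} first hit (suc n) rewrite first = stuck n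
  where
  h = ((u , Vs) , choose A [] (u , Vs)) ∷ []
  hit′ : ∀ {g} → g ∈ edges H → Any (_∈ covered h) g
  hit′ g∈ = Any.map ∈-++⁺ˡ (hit g∈)
  stuck : ∀ n → length (runFrom A H n h) ≤ 1
  stuck zero = ≤-refl
  stuck (suc n) rewrite covered⇒eligible≡[] H h hit′ = ≤-refl

-- Uniform hypergraphs on a bounded set of labels

module _ (k N : ℕ) where

  kSubsets : List Edge
  kSubsets = filter (λ e → length e ≟ k) (sublists (upTo N))

  ∈-kSubsets⁻ : ∀ {e} → e ∈ kSubsets → AllPairs _<_ e × length e ≡ k × e ⊆ upTo N
  ∈-kSubsets⁻ e∈ with ∈-filter⁻ (λ e → length e ≟ k) {xs = sublists (upTo N)} e∈
  ... | e∈′ , len = sublists-AllPairs (AllPairsₚ.applyUpTo⁺₁ id N λ i<j _ → i<j) e∈′ , len , sublists-⊆ e∈′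

  kSubset-length : ∀ {e} → e ∈ kSubsets → length e ≡ k
  kSubset-length = proj₁ ∘ proj₂ ∘ ∈-kSubsets⁻

  kSubset-unique : ∀ {e} → e ∈ kSubsets → Unique e
  kSubset-unique e∈ = AllPairs.map (λ x<y x≡y → <-irrefl x≡y x<y) (proj₁ (∈-kSubsets⁻ e∈))

  kSubsets-Lex : AllPairs (Lex-< _≡_ _<_) kSubsets
  kSubsets-Lex = lex (AllPairsₚ.filter⁺ _ (sublists-Lex (AllPairsₚ.applyUpTo⁺₁ id N λ i<j _ → i<j)))
                     (Allₚ.all-filter _ (sublists (upTo N)))
    where
    lex : ∀ {es} → AllPairs (λ ys zs → length ys ≡ length zs → Lex-< _≡_ _<_ ys zs) es →
          All (λ e → length e ≡ k) es → AllPairs (Lex-< _≡_ _<_) es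
    lex [] [] = []
    lex (p ∷ ps) (l ∷ ls) = All.zipWith (λ (f , l′) → f (trans l (sym l′))) (p , ls) ∷ lex ps ls

  -- Since `kSubsets` is already in canonical order, an arbitrary list `T`, in any order and with
  -- repetitions, determines a hypergraph in canonical form.
  restrict : List Edge → Hypergraph k
  restrict T = record
    { edges     = filter (_∈ᴱ? T) kSubsets
    ; sorted    = Allₚ.filter⁺ (_∈ᴱ? T) (All.tabulate λ e∈ → AllPairs⇒Linked (proj₁ (∈-kSubsets⁻ e∈)))
    ; uniform   = Allₚ.filter⁺ (_∈ᴱ? T) (All.tabulate kSubset-length)
    ; canonical = AllPairs⇒Linked (AllPairsₚ.filter⁺ (_∈ᴱ? T) kSubsets-Lex)
    }

  ∈-restrict⁻ : ∀ {T e} → e ∈ edges (restrict T) → e ∈ kSubsets × e ∈ T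
  ∈-restrict⁻ {T} = ∈-filter⁻ (_∈ᴱ? T) {xs = kSubsets}

  ∈-restrict⁺ : ∀ {T e} → e ∈ kSubsets → e ∈ T → e ∈ edges (restrict T)
  ∈-restrict⁺ {T} = ∈-filter⁺ (_∈ᴱ? T)

  -- Here `m` counts the labels still missing from the seed `S`, and `L` lists labels to avoid.
  -- While a label is missing, `L` and `S` together have fewer than `N` entries, so a fresh one
  -- exists. The seed itself may meet `L`.
  extend : ∀ m S L → Unique S → S ⊆ upTo N → m + length S ≡ k → length L + k ≤ N →
           ∃ λ f → f ∈ kSubsets × S ⊆ f × (∀ {y} → y ∈ f → y ∈ S ⊎ y ∉ L)
  extend zero S L S! S⊆ len _ =
    -- The seed is complete; filtering `upTo N` by it sorts it.
    f , ∈-filter⁺ _ (filter∈sublists (_∈? S) (upTo N)) (trans len′ len) , S⊆f , inj₁ ∘ f⊆S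
    where
    f = filter (_∈? S) (upTo N)
    f⊆S : f ⊆ S
    f⊆S = proj₂ ∘ ∈-filter⁻ (_∈? S) {xs = upTo N}
    S⊆f : S ⊆ f
    S⊆f s = ∈-filter⁺ (_∈? S) (S⊆ s) s
    len′ : length f ≡ length S
    len′ = ≤-antisym (unique-⊆⇒length-≤ (Uniqueₚ.filter⁺ (_∈? S) (Uniqueₚ.upTo⁺ N)) f⊆S)
                     (unique-⊆⇒length-≤ S! S⊆f)
  extend (suc m) S L S! S⊆ len bound with longer⇒∃∉ {ys = L ++ S} (Uniqueₚ.upTo⁺ N) short
    where
    open ≤-Reasoning
    short : length (L ++ S) < length (upTo N)
    short = begin-strict
      length (L ++ S)           ≡⟨ length-++ L ⟩
      length L + length S       <⟨ +-monoʳ-< (length L) (s≤s (m≤n+m (length S) m)) ⟩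
      length L + (suc m + length S) ≡⟨ cong (length L +_) len ⟩
      length L + k              ≤⟨ bound ⟩
      N                         ≡⟨ length-upTo N ⟨
      length (upTo N)           ∎
  ... | x , x∈ , x∉ with extend m (x ∷ S) L
    (All.tabulate (λ y∈ x≡y → x∉ (∈-++⁺ʳ L (subst (_∈ S) (sym x≡y) y∈))) ∷ S!)
    (λ { (here refl) → x∈ ; (there s) → S⊆ s })
    (trans (+-suc m (length S)) len) bound
  ...   | f , f∈ , S⊆f , f⊆ = f , f∈ , S⊆f ∘ there , λ y∈ → old (f⊆ y∈)
    where
    old : ∀ {y} → y ∈ x ∷ S ⊎ y ∉ L → y ∈ S ⊎ y ∉ L
    old (inj₁ (here refl)) = inj₂ (x∉ ∘ ∈-++⁺ˡ)
    old (inj₁ (there y∈))  = inj₁ y∈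
    old (inj₂ y∉)          = inj₂ y∉

  -- Rich nodes and their data items

  MeetsOnlyIn : ℕ → Edge → Edge → Set
  MeetsOnlyIn w g f = w ∈ f × All (λ y → y ≡ w ⊎ y ∉ f) g

  -- Only edges at `w` matter, so richness at `w` survives changes to the other edges. The first
  -- component ensures that an algorithm receiving `w` has an edge to choose.
  Rich : List Edge → ℕ → Set
  Rich T w = Any (w ∈_) (edges (restrict T)) ×
             All (λ g → w ∈ g → Any (MeetsOnlyIn w g) (edges (restrict T))) (edges (restrict T))

  rich? : ∀ T w → Dec (Rich T w)
  rich? T w = any? (w ∈?_) es ×-dec
    all? (λ g → (w ∈? g) →-dec any? (λ f → (w ∈? f) ×-dec all? (λ y → (y ≟ w) ⊎-dec ¬? (y ∈? f)) g) es) es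
    where es = edges (restrict T)

  -- All edge sets on `N` labels are enumerated, so the first of the resulting items is determined
  -- by the initial order alone.
  richPairs : List (List Edge × ℕ)
  richPairs = filter (λ (T , w) → rich? T w) (cartesianProduct (sublists kSubsets) (upTo N))

  itemOf : List Edge × ℕ → Item
  itemOf (T , w) = dataItem (restrict T) w

  richItems : List Item
  richItems = map itemOf richPairs

  -- The adversary's hypergraph

  module Adversary (3≤k : 3 ≤ k) (kk+2k≤N : k * k + k + k ≤ N)
                   (T : List Edge) (u : ℕ) (e : Edge)
                   (e∈ : e ∈ edges (restrict T)) (u∈e : u ∈ e) (rich-u : Rich T u) where

    -- The last condition, that g does not contain e ∖ {u}, lets an edge at w ∉ e
    -- meet e outside g.
    Added : Edge → Set
    Added g = u ∉ g × Any (_∈ g) e × Any (λ v → v ≢ u × v ∉ g) e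

    Kept : Edge → Set
    Kept g = (u ∈ g × g ∈ T) ⊎ Added g

    kept? : ∀ g → Dec (Kept g)
    kept? g = ((u ∈? g) ×-dec (g ∈ᴱ? T)) ⊎-dec
              (¬? (u ∈? g) ×-dec any? (_∈? g) e ×-dec any? (λ v → ¬? (v ≟ u) ×-dec ¬? (v ∈? g)) e)

    T′ : List Edge
    T′ = filter kept? kSubsets

    H : Hypergraph k
    H = restrict T′

    ∈-H⁺ : ∀ {g} → g ∈ kSubsets → Kept g → g ∈ edges H
    ∈-H⁺ g∈ kept = ∈-restrict⁺ g∈ (∈-filter⁺ kept? g∈ kept)

    ∈-H⁻ : ∀ {g} → g ∈ edges H → g ∈ kSubsets × Kept g
    ∈-H⁻ g∈ = ∈-filter⁻ kept? {xs = kSubsets} (proj₂ (∈-restrict⁻ g∈))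

    star⊆H : ∀ {g} → u ∈ g → g ∈ edges (restrict T) → g ∈ edges H
    star⊆H u∈g g∈ with ∈-restrict⁻ g∈
    ... | g∈B , g∈T = ∈-H⁺ g∈B (inj₁ (u∈g , g∈T))

    star-H : ∀ {g} → u ∈ g → g ∈ edges H → g ∈ edges (restrict T)
    star-H u∈g g∈ with ∈-H⁻ g∈
    ... | g∈B , inj₁ (_ , g∈T)   = ∈-restrict⁺ g∈B g∈T
    ... | _   , inj₂ (u∉g , _) = contradiction u∈g u∉g

    -- Added edges avoid `u`, and the edges of `T` at `u` are kept, so an algorithm receiving `u`
    -- first cannot tell `H` from `restrict T`.
    dataItem-u : dataItem H u ≡ dataItem (restrict T) u
    dataItem-u = cong (λ es → u , map (remove u) es)
      (filter-filter-cong (_∈ᴱ? T′) (_∈ᴱ? T) (u ∈?_) kSubsets λ g∈ u∈g →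
        (λ g∈T′ → proj₂ (∈-restrict⁻ (star-H u∈g (∈-restrict⁺ g∈ g∈T′)))) ,
        (λ g∈T → proj₂ (∈-restrict⁻ (star⊆H u∈g (∈-restrict⁺ g∈ g∈T)))))

    e-meets : ∀ {g} → g ∈ edges H → ∃ λ x → x ∈ e × x ∈ g
    e-meets g∈ with ∈-H⁻ g∈
    ... | _ , inj₁ (u∈g , _)     = u , u∈e , u∈g
    ... | _ , inj₂ (_ , hit , _) = find hit

    -- Added edges and the richness of `H`

    e∈B : e ∈ kSubsets
    e∈B = proj₁ (∈-restrict⁻ e∈)

    e! : Unique e
    e! = kSubset-unique e∈B

    |e|≡k : length e ≡ k
    |e|≡k = kSubset-length e∈B

    -- This is where `k ≥ 3` enters: an edge meeting `e` only in `v` still misses a node of `e`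
    -- other than `u`, as `Added` demands.
    third : ∀ v → ∃ λ x → x ∈ e × x ∉ u ∷ v ∷ []
    third v = longer⇒∃∉ e! (subst (3 ≤_) (sym |e|≡k) 3≤k)

    -- Avoiding all of `e` outside `S` keeps `u` and `v` out of the new edge. Then `x` witnesses
    -- that it meets `e`, and `v` that it misses a node other than `u`.
    added-edge : ∀ S L {v x} → Unique S → S ⊆ upTo N → length S ≤ k → length L ≤ k * k →
                 u ∉ S → x ∈ e → x ∈ S → v ∈ e → v ≢ u → v ∉ S →
                 ∃ λ f → f ∈ edges H × S ⊆ f × (∀ {y} → y ∈ f → y ∈ S ⊎ y ∉ L ++ e)
    added-edge S L {v} {x} S! S⊆ S≤k L≤kk u∉S x∈e x∈S v∈e v≢u v∉S
      with extend (k ∸ length S) S (L ++ e) S! S⊆ (m∸n+n≡m S≤k) bound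
      where
      open ≤-Reasoning
      bound : length (L ++ e) + k ≤ N
      bound = begin
        length (L ++ e) + k       ≡⟨ cong (_+ k) (length-++ L) ⟩
        length L + length e + k   ≡⟨ cong (λ n → length L + n + k) |e|≡k ⟩
        length L + k + k          ≤⟨ +-monoˡ-≤ k (+-monoˡ-≤ k L≤kk) ⟩
        k * k + k + k             ≤⟨ kk+2k≤N ⟩
        N                         ∎
    ... | f , f∈ , S⊆f , f⊆ =
      f , ∈-H⁺ f∈ (inj₂ (avoid u∈e u∉S , lose x∈e (S⊆f x∈S) , lose v∈e (v≢u , avoid v∈e v∉S))) , S⊆f , f⊆
      where
      avoid : ∀ {y} → y ∈ e → y ∉ S → y ∉ f
      avoid y∈e y∉S y∈f with f⊆ y∈f
      ... | inj₁ y∈S = y∉S y∈S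
      ... | inj₂ y∉  = y∉ (∈-++⁺ʳ L y∈e)

    -- With `g` as the list to avoid, the new edge meets `g` only inside the seed, and there only in
    -- `w`.
    meeting-edge : ∀ w g S {v x} → w ∈ S → (∀ {y} → y ∈ g → y ∈ S → y ≡ w) → g ∈ kSubsets →
                   Unique S → S ⊆ upTo N → length S ≤ k →
                   u ∉ S → x ∈ e → x ∈ S → v ∈ e → v ≢ u → v ∉ S →
                   Any (MeetsOnlyIn w g) (edges H)
    meeting-edge w g S w∈S only g∈B S! S⊆ S≤k u∉S x∈e x∈S v∈e v≢u v∉S
      with added-edge S g S! S⊆ S≤k |g|≤kk u∉S x∈e x∈S v∈e v≢u v∉S
      where
      open ≤-Reasoning
      |g|≤kk : length g ≤ k * k
      |g|≤kk = begin
        length g ≡⟨ kSubset-length g∈B ⟩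
        k        ≡⟨ +-identityʳ k ⟨
        1 * k    ≤⟨ *-monoˡ-≤ k (≤-trans (s≤s z≤n) 3≤k) ⟩
        k * k    ∎
    ... | f , f∈ , S⊆f , f⊆ = lose f∈ (S⊆f w∈S , All.tabulate meets)
      where
      meets : ∀ {y} → y ∈ g → y ≡ w ⊎ y ∉ f
      meets {y} y∈g with y ∈? f
      ... | no y∉f  = inj₂ y∉f
      ... | yes y∈f with f⊆ y∈f
      ...   | inj₁ y∈S = inj₁ (only y∈g y∈S)
      ...   | inj₂ y∉g = contradiction (∈-++⁺ˡ y∈g) y∉g

    -- For an added edge this is part of the definition. A kept edge at `u` has `k` nodes including
    -- `w` outside `e`, so too few are left to contain `e`; the missed node is not `u`, which lies
    -- in `g`.
    missed-by : ∀ {w g} → g ∈ edges H → w ∈ g → w ∉ e → ∃ λ v → v ∈ e × v ≢ u × v ∉ g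
    missed-by {w} {g} g∈ w∈g w∉e with ∈-H⁻ g∈
    ... | _ , inj₂ (_ , _ , missed) = find missed
    ... | g∈B , inj₁ (u∈g , _) with longer⇒∃∉ {ys = remove w g} e! short
      where
      short : length (remove w g) < length e
      short = <-≤-trans (filter-notAll _ g (lose w∈g (λ w≢w → w≢w refl)))
                        (≤-reflexive (trans (kSubset-length g∈B) (sym |e|≡k)))
    ...   | v , v∈e , v∉ = v , v∈e , (λ { refl → v∉g u∈g }) , v∉g
      where
      v∉g : v ∉ g
      v∉g v∈g = v∉ (∈-filter⁺ _ v∈g (λ { refl → w∉e v∈e }))

    -- At `u` the edges are those of `T`, so richness is inherited. Elsewhere an added edge serves,
    -- with a seed depending on whether `w` lies in `e`.
    meets-only-in : ∀ w {g} → g ∈ edges H → w ∈ g → Any (MeetsOnlyIn w g) (edges H)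
    meets-only-in w {g} g∈ w∈g with w ≟ u
    ... | yes refl with find (All.lookup (proj₂ rich-u) (star-H w∈g g∈) w∈g)
    ...   | f , f∈ , u∈f , only = lose (star⊆H u∈f f∈) (u∈f , only)
    meets-only-in w {g} g∈ w∈g | no w≢u with proj₁ (∈-H⁻ g∈) | w ∈? e
    ... | g∈B | yes w∈e with third w
    ...   | v , v∈e , v∉ =
      -- The seed `w` already meets `e`; `v` is the node of `e` left out.
      meeting-edge w g (w ∷ []) (here refl) (λ { _ (here eq) → eq }) g∈B
        ([] ∷ []) (λ { (here refl) → proj₂ (proj₂ (∈-kSubsets⁻ g∈B)) w∈g }) (≤-trans (s≤s z≤n) 3≤k)
        (λ { (here eq) → w≢u (sym eq) }) w∈e (here refl)
        v∈e (v∉ ∘ here) (v∉ ∘ there)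
    meets-only-in w {g} g∈ w∈g | no w≢u | g∈B | no w∉e with missed-by g∈ w∈g w∉e
    ...   | v , v∈e , v≢u , v∉g with third v
    ...     | x , x∈e , x∉ =
      -- The seed needs a node of `e` as well; taking one missed by `g` leaves `w` as the only
      -- common node.
      meeting-edge w g (v ∷ w ∷ []) (there (here refl))
        (λ { y∈g (here refl) → contradiction y∈g v∉g ; _ (there (here eq)) → eq }) g∈B
        (((λ { refl → w∉e v∈e }) ∷ []) ∷ [] ∷ [])
        (λ { (here refl) → proj₂ (proj₂ (∈-kSubsets⁻ e∈B)) v∈e
           ; (there (here refl)) → proj₂ (proj₂ (∈-kSubsets⁻ g∈B)) w∈g })
        (≤-trans (s≤s (s≤s z≤n)) 3≤k)
        (λ { (here eq) → v≢u (sym eq) ; (there (here eq)) → w≢u (sym eq) })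
        v∈e (here refl) x∈e (x∉ ∘ here)
        (λ { (here refl) → x∉ (there (here refl)) ; (there (here refl)) → w∉e x∈e })

    H-rich : ∀ {w} → w ∈ vertices H → Rich T′ w
    H-rich {w} w∈ = ∈-concatMap⁻ id w∈ , All.tabulate (meets-only-in w)

    -- The list `T′` is itself a sublist of `kSubsets`, so `H` is among the enumerated hypergraphs.
    ∈-richItems : ∀ {w} → w ∈ vertices H → dataItem H w ∈ richItems
    ∈-richItems {w} w∈ with find (∈-concatMap⁻ id {xs = edges H} w∈)
    ... | g , g∈ , w∈g = ∈-map⁺ itemOf (∈-filter⁺ _
      (∈-cartesianProduct⁺ (filter∈sublists kept? kSubsets) (proj₂ (proj₂ (∈-kSubsets⁻ (proj₁ (∈-H⁻ g∈)))) w∈g))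
      (H-rich w∈))

    disjoint-edges : ∀ vs → Unique vs → vs ⊆ remove u e → length vs < k →
      ∃ λ M → IsMatching M × M ⊆ edges H × length M ≡ suc (length vs) ×
              (∀ {x} → x ∈ e → x ∈ concat M → x ∈ u ∷ vs)
    -- Richness at `u`, applied to `e` itself, gives an edge meeting `e` only in `u`.
    disjoint-edges [] _ _ _ with find (All.lookup (proj₂ rich-u) e∈ u∈e)
    ... | f , f∈ , u∈f , only = f ∷ [] , [] ∷ [] , (λ { (here refl) → star⊆H u∈f f∈ }) , refl , in-u
      where
      in-u : ∀ {x} → x ∈ e → x ∈ f ++ [] → x ∈ u ∷ []
      in-u x∈e x∈ with ∈-++⁻ f x∈ | All.lookup only x∈e
      ... | inj₁ _   | inj₁ x≡u = here x≡u
      ... | inj₁ x∈f | inj₂ x∉f = contradiction x∈f x∉f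
    disjoint-edges (v ∷ vs) (v∉ ∷ vs!) sub vs<k
      with disjoint-edges vs vs! (sub ∘ there) (<⇒≤ vs<k)
         | third v | ∈-filter⁻ (λ x → ¬? (x ≟ u)) {xs = e} (sub (here refl))
    ... | M , M# , M⊆ , len , in-M | x , x∈e , x∉ | v∈e , v≢u
      -- The new edge avoids everything used so far and all of `e` except `v`.
      with added-edge (v ∷ []) (concat M) ([] ∷ [])
             (λ { (here refl) → proj₂ (proj₂ (∈-kSubsets⁻ e∈B)) v∈e }) (≤-trans (s≤s z≤n) 3≤k) bound
             (λ { (here eq) → v≢u (sym eq) }) v∈e (here refl) x∈e (x∉ ∘ here) (x∉ ∘ there)
      where
      open ≤-Reasoning
      bound : length (concat M) ≤ k * k
      bound = begin
        length (concat M) ≡⟨ length-concat (All.tabulate (λ f∈ → kSubset-length (proj₁ (∈-H⁻ (M⊆ f∈))))) ⟩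
        length M * k      ≡⟨ cong (_* k) len ⟩
        suc (length vs) * k ≤⟨ *-monoˡ-≤ k (<⇒≤ vs<k) ⟩
        k * k             ∎
    ... | f , f∈ , v∈f , f⊆ =
      f ∷ M , All.tabulate f# ∷ M# , (λ { (here refl) → f∈ ; (there h∈) → M⊆ h∈ }) , cong suc len , in-f∷M
      where
      v∉M : v ∉ concat M
      v∉M v∈ with in-M v∈e v∈
      ... | here v≡u   = v≢u v≡u
      ... | there v∈vs = All.lookup v∉ v∈vs refl
      f# : ∀ {h} → h ∈ M → Disjoint f h
      f# {h} h∈ = All.tabulate λ y∈f y∈h → disjoint (f⊆ y∈f) (∈-concat⁺′ y∈h h∈)
        where
        disjoint : ∀ {y} → y ∈ v ∷ [] ⊎ y ∉ concat M ++ e → y ∉ concat M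
        disjoint (inj₁ (here refl)) = v∉M
        disjoint (inj₂ y∉)          = y∉ ∘ ∈-++⁺ˡ
      in-f∷M : ∀ {y} → y ∈ e → y ∈ f ++ concat M → y ∈ u ∷ v ∷ vs
      in-f∷M y∈e y∈ with ∈-++⁻ f y∈
      in-f∷M y∈e y∈ | inj₁ y∈f with f⊆ y∈f
      ... | inj₁ (here refl) = there (here refl)
      ... | inj₂ y∉          = contradiction (∈-++⁺ʳ (concat M) y∈e) y∉
      in-f∷M y∈e y∈ | inj₂ y∈M with in-M y∈e y∈M
      ... | here y≡u   = here y≡u
      ... | there y∈vs = there (there y∈vs)

    k≤ν : k ≤ ν H
    k≤ν with disjoint-edges (remove u e) (Uniqueₚ.filter⁺ _ e!) id short
      where
      short : length (remove u e) < k
      short = <-≤-trans (filter-notAll _ e (lose u∈e (λ u≢u → u≢u refl))) (≤-reflexive |e|≡k)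
    ... | M , M# , M⊆ , len , _ = ≤-trans k≤M (matching≤ν H (≤-trans (s≤s z≤n) 3≤k) M# M⊆)
      where
      e⊆ : e ⊆ u ∷ remove u e
      e⊆ {x} x∈ with x ≟ u
      ... | yes refl = here refl
      ... | no x≢u   = there (∈-filter⁺ _ x∈ x≢u)
      k≤M : k ≤ length M
      k≤M = subst (_≤ length M) |e|≡k (≤-trans (unique-⊆⇒length-≤ e! e⊆) (≤-reflexive (sym len)))

-- The first round and the final count

theorem9 : (k : ℕ) → 3 ≤ k → (A : Algorithm) →
    Σ (Hypergraph k) (λ H → 1 ≤ ν H × k * output A H ≤ ν H)
theorem9 k 3≤k A = answer
  where
  -- Room for up to `k` earlier edges, for `e`, and for one new edge.
  N = k * k + k + k

  0<k : 0 < k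
  0<k = ≤-trans (s≤s z≤n) 3≤k

  0∈N : 0 ∈ upTo N
  0∈N = ∈-upTo⁺ (≤-trans 0<k (m≤n+m k (k * k + k)))

  initial : ∀ L → length L ≤ k → ∃ λ f → f ∈ edges (restrict k N (kSubsets k N)) × 0 ∈ f ×
                                       (∀ {y} → y ∈ f → y ∈ 0 ∷ [] ⊎ y ∉ L)
  initial L L≤k with extend k N (k ∸ 1) (0 ∷ []) L ([] ∷ []) (λ { (here refl) → 0∈N }) (m∸n+n≡m 0<k)
    (+-monoˡ-≤ k (≤-trans L≤k (m≤n+m k (k * k))))
  ... | f , f∈ , 0∈f , f⊆ = f , ∈-restrict⁺ k N f∈ f∈ , 0∈f (here refl) , f⊆

  -- A first rich item requires that one exists. In the complete hypergraph `N` leaves room for an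
  -- edge through `0` that otherwise avoids a given edge.
  complete-rich : Rich k N (kSubsets k N) 0
  complete-rich with initial [] z≤n
  ... | f , f∈ , 0∈f , _ = lose f∈ 0∈f , All.tabulate λ {g} g∈ _ → only g g∈
    where
    only : ∀ g → g ∈ edges (restrict k N (kSubsets k N)) →
           Any (MeetsOnlyIn k N 0 g) (edges (restrict k N (kSubsets k N)))
    only g g∈ with initial g (≤-reflexive (kSubset-length k N (proj₁ (∈-restrict⁻ k N g∈))))
    ... | f , f∈ , 0∈f , f⊆ = lose f∈ (0∈f , All.tabulate meets)
      where
      meets : ∀ {y} → y ∈ g → y ≡ 0 ⊎ y ∉ f
      meets {y} y∈g with y ∈? f
      ... | no y∉f  = inj₂ y∉f
      ... | yes y∈f with f⊆ y∈f
      ...   | inj₁ (here y≡0) = inj₁ y≡0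
      ...   | inj₂ y∉g        = contradiction y∈g y∉g

  complete∈ : (kSubsets k N , 0) ∈ richPairs k N
  complete∈ = ∈-filter⁺ _ (∈-cartesianProduct⁺ all∈ 0∈N) complete-rich
    where
    all∈ : kSubsets k N ∈ sublists (kSubsets k N)
    all∈ = subst (_∈ sublists (kSubsets k N)) (filter-all U? (All.universal-U (kSubsets k N)))
                 (filter∈sublists U? (kSubsets k N))

  answer : Σ (Hypergraph k) (λ H → 1 ≤ ν H × k * output A H ≤ ν H)
  -- This item is fixed before the input `H` is built.
  answer with firstItem-just A [] (∈-map⁺ (itemOf k N) complete∈)
  ... | it , first with ∈-map⁻ (itemOf k N) (firstItem-∈ A [] first)
  ...   | (T , u) , Tu∈ , refl with proj₂ (∈-filter⁻ (λ (T , w) → rich? k N T w)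
                                           {xs = cartesianProduct (sublists (kSubsets k N)) (upTo N)} Tu∈)
  ...     | rich-u with find (proj₁ rich-u)
  -- With an empty history every edge is free, so the valid choice of `A` is some edge `e` at `u`
  -- with `u` removed.
  ...       | g , g∈ , u∈g with ∈-map⁻ (remove u)
    (proj₁ (choose-valid A [] u _
      (lose (∈-map⁺ (remove u) (∈-filter⁺ (u ∈?_) g∈ u∈g)) (All.universal (λ _ ()) (remove u g)))))
  ...         | e , e∈star , chosen≡ with ∈-filter⁻ (u ∈?_) {xs = edges (restrict k N T)} e∈star
  ...           | e∈ , u∈e = H , ≤-trans 0<k k≤ν , (begin
    k * output A H ≤⟨ *-monoʳ-≤ k (runFrom-single A H first-H hit (length (edges H))) ⟩
    k * 1          ≡⟨ *-identityʳ k ⟩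
    k              ≤⟨ k≤ν ⟩
    ν H            ∎)
    where
    open ≤-Reasoning
    open Adversary k N 3≤k ≤-refl T u e e∈ u∈e rich-u

    items-H : List Item
    items-H = map (dataItem H) (eligibleNodes H [])

    items-H⊆ : items-H ⊆ richItems k N
    items-H⊆ z∈ with ∈-map⁻ (dataItem H) z∈
    ... | w , w∈ , refl = ∈-richItems (proj₁ (∈-filter⁻ _ {xs = vertices H} w∈))

    u∈eligible : u ∈ eligibleNodes H []
    u∈eligible = ∈-filter⁺ _ (∈-concatMap⁺ id (lose e∈H u∈e)) (lose e∈H (u∈e , All.universal (λ _ ()) e))
      where e∈H = star⊆H u∈e e∈

    first-H : firstItem A [] items-H ≡ just (dataItem (restrict k N T) u)
    -- All items of `H` are rich items, and that of `u` is among them unchanged.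
    first-H = firstItem-⊆ A [] first items-H⊆ (subst (_∈ items-H) dataItem-u (∈-map⁺ (dataItem H) u∈eligible))

    hit : ∀ {g} → g ∈ edges H → Any (_∈ u ∷ choose A [] (dataItem (restrict k N T) u)) g
    hit g∈ with e-meets g∈
    ... | x , x∈e , x∈g with x ≟ u
    ...   | yes x≡u = lose x∈g (here x≡u)
    ...   | no x≢u  = lose x∈g (there (subst (x ∈_) (sym chosen≡) (∈-filter⁺ _ x∈e x≢u)))
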